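{- Let $(E,\oplus,0)$ be a PCM whose extension preorder has binary joins, written $a\vee b$, and let $\mathbb{C}$ be an $E$-graded monoidal category. There is a category, also denoted by $\mathbb{C}$, with objects $\mathbb{C}_{\mathrm{obj}}$ and hom-sets $\mathbb{C}(X;Y):=\coprod_{a\in E}\mathbb{C}_a(X;Y)$. Identities are given by the grade $0$ identities $\mathrm{id}_X$, and composition for $f\in\mathbb{C}_a(X;Y)$ and $g\in\mathbb{C}_b(Y;Z)$ is given by $$f\,;\,g:=f_a^{a\vee b}\,;_{a\vee b}\,g_b^{a\vee b}.$$
   Context: **PCMs.** A partial commutative monoid (PCM) $(E,\oplus,0)$ is a set $E$ with a partial function $\oplus:E\times E\rightharpoonup E$ and an element $0\in E$ such that $a\oplus b\simeq b\oplus a$, $a\oplus 0=a=0\oplus a$, $(a\oplus b)\oplus c\simeq a\oplus(b\oplus c)$, where $\simeq$ means: if either side is defined then both are, and they are equal. Write $a\perp b$ when $a\oplus b$ is defined. The extension preorder on $E$ is: $a\leqslant b$ iff there is $c$ with $a\oplus c=b$. **Graded monoidal categories.** An $E$-graded monoidal category $\mathbb{C}$ consists of: a monoid of objects $(\mathbb{C}_{\mathrm{obj}},\otimes,I)$; for each $a\in E$ a category $\mathbb{C}_a$ with set of objects $\mathbb{C}_{\mathrm{obj}}$, hom-sets $\mathbb{C}_a(X;Y)$, composition written diagrammatically $f\,;_a g$ (subscript often omitted); the identities of $\mathbb{C}_0$ are written $\mathrm{id}_X$; for each $a\leqslant b$ an identity-on-objects functor $(-)_a^b:\mathbb{C}_a\to\mathbb{C}_b$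 (regrading); for each $a\perp b$ operations $\otimes_{a,b}:\mathbb{C}_a(X;Y)\times\mathbb{C}_b(X';Y')\to\mathbb{C}_{a\oplus b}(X\otimes X';Y\otimes Y')$. Axioms, whenever well typed: $f_a^a=f$ and $(f_a^b)_b^c=f_a^c$; $(f\otimes g)_{a\oplus b}^{c\oplus d}=f_a^c\otimes g_b^d$ for $f\in\mathbb{C}_a$, $g\in\mathbb{C}_b$; $f\otimes\mathrm{id}_I=f=\mathrm{id}_I\otimes f$ and $(f\otimes g)\otimes h=f\otimes(g\otimes h)$; $\mathrm{id}_X\otimes\mathrm{id}_Y=\mathrm{id}_{X\otimes Y}$; $(f\otimes g);(h\otimes k)=(f;h)\otimes(g;k)$ for $f\in\mathbb{C}_a(X;Y)$, $h\in\mathbb{C}_a(Y;Z)$, $g\in\mathbb{C}_b(X';Y')$, $k\in\mathbb{C}_b(Y';Z')$.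
   Formalization: The extension preorder is additionally assumed antisymmetric, so that the join a ∨ b is a uniquely determined element; for an arbitrary choice of joins in a mere preorder (e.g. E = Z/2 with a ∨ b always 1) the identity laws fail. -}

module Defs where

open import Algebra.Core using (Op₂)
open import Algebra.Structures using (IsMonoid)
open import Data.Product using (Σ-syntax; ∃; _×_; _,_; proj₁; proj₂)
open import Function.Bundles using (_⇔_)
open import Level using (Level; _⊔_; suc)
open import Relation.Binary.HeterogeneousEquality using (_≅_)
open import Relation.Binary.PropositionalEquality using (_≡_)

private variable
  ℓ e d o h : Level

-- A partial element of A.  The proof of definedness is irrelevant, so Dom acts
-- as a mere proposition; it is not required to be decidable.

record Partial (A : Set ℓ) (d : Level) : Set (ℓ ⊔ suc d) where
  field
    Dom : Set d
    val : .Dom → A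

open Partial public

infix 4 _≃_ _⇓_
infixl 1 _>>=_

_≃_ : {A : Set ℓ} → Partial A d → Partial A d → Set (ℓ ⊔ d)
x ≃ y = (Dom x ⇔ Dom y) × (∀ (p : Dom x) (q : Dom y) → val x p ≡ val y q)

-- x is defined, with value v.
_⇓_ : {A : Set ℓ} → Partial A d → A → Set (ℓ ⊔ d)
x ⇓ v = Σ[ p ∈ Dom x ] val x p ≡ v

-- Defined iff x is defined and f is defined at its value.
_>>=_ : {A B : Set ℓ} → Partial A d → (A → Partial B d) → Partial B d
Dom (x >>= f)    = Σ[ p ∈ Dom x ] Dom (f (val x p))
val (x >>= f) pq = val (f (val x (proj₁ pq))) (proj₂ pq)

record PCM (e d : Level) : Set (suc (e ⊔ d)) where
  infixl 6 _⊕_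
  infix  4 _⊥_ _≤_
  field
    E   : Set e
    _⊕_ : E → E → Partial E d
    𝟘   : E

    ⊕-comm      : ∀ a b → a ⊕ b ≃ b ⊕ a
    ⊕-identityʳ : ∀ a → a ⊕ 𝟘 ⇓ a
    ⊕-identityˡ : ∀ a → 𝟘 ⊕ a ⇓ a
    ⊕-assoc     : ∀ a b c → (a ⊕ b >>= λ x → x ⊕ c) ≃ (b ⊕ c >>= λ y → a ⊕ y)

  _⊥_ : E → E → Set d
  a ⊥ b = Dom (a ⊕ b)

  _≤_ : E → E → Set (e ⊔ d)
  a ≤ b = ∃ λ c → a ⊕ c ⇓ b

record IsCategory {Obj : Set o} (Hom : Obj → Obj → Set h)
                  (id : ∀ {X} → Hom X X)
                  (_⨾_ : ∀ {X Y Z} → Hom X Y → Hom Y Z → Hom X Z)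
                  : Set (o ⊔ h) where
  field
    identityˡ : ∀ {X Y} (f : Hom X Y) → id ⨾ f ≡ f
    identityʳ : ∀ {X Y} (f : Hom X Y) → f ⨾ id ≡ f
    assoc     : ∀ {W X Y Z} (f : Hom W X) (g : Hom X Y) (k : Hom Y Z) →
                (f ⨾ g) ⨾ k ≡ f ⨾ (g ⨾ k)

-- Laws between arrows whose grades or (co)domains agree only propositionally,
-- by the PCM laws and the monoid laws on objects, use heterogeneous equality.
-- Laws mentioning regradings or tensors are quantified over all proofs making
-- both sides well typed.

record GradedMonoidalCategory (P : PCM e d) (o h : Level)
       : Set (e ⊔ d ⊔ suc (o ⊔ h)) where
  open PCM P
  infixr 7 _⊗₀_
  infixl 5 _⨾_
  field
    Obj      : Set o
    _⊗₀_     : Op₂ Obj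
    I        : Obj
    isMonoid : IsMonoid _≡_ _⊗₀_ I

    Hom        : E → Obj → Obj → Set h
    id         : ∀ {a X} → Hom a X X
    _⨾_        : ∀ {a X Y Z} → Hom a X Y → Hom a Y Z → Hom a X Z
    isCategory : ∀ a → IsCategory (Hom a) id _⨾_

    regrade    : ∀ {a b X Y} → .(a ≤ b) → Hom a X Y → Hom b X Y
    regrade-id : ∀ {a b X} (p : a ≤ b) → regrade p (id {a} {X}) ≡ id
    regrade-⨾  : ∀ {a b X Y Z} (p : a ≤ b) (f : Hom a X Y) (g : Hom a Y Z) →
                 regrade p (f ⨾ g) ≡ regrade p f ⨾ regrade p g

    tensor : ∀ {a b X Y X′ Y′} .(p : a ⊥ b) → Hom a X Y → Hom b X′ Y′ →
             Hom (val (a ⊕ b) p) (X ⊗₀ X′) (Y ⊗₀ Y′)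

    regrade-refl  : ∀ {a X Y} (p : a ≤ a) (f : Hom a X Y) → regrade p f ≡ f
    regrade-trans : ∀ {a b c X Y} (p : a ≤ b) (q : b ≤ c) (r : a ≤ c)
                    (f : Hom a X Y) → regrade q (regrade p f) ≡ regrade r f

    regrade-tensor : ∀ {a b c d X Y X′ Y′} (p : a ⊥ b) (q : c ⊥ d)
                     (r : a ≤ c) (s : b ≤ d)
                     (t : val (a ⊕ b) p ≤ val (c ⊕ d) q)
                     (f : Hom a X Y) (g : Hom b X′ Y′) →
                     regrade t (tensor p f g) ≡ tensor q (regrade r f) (regrade s g)

    tensor-identityʳ : ∀ {a X Y} (p : a ⊥ 𝟘) (f : Hom a X Y) →
                       tensor p f (id {𝟘} {I}) ≅ f
    tensor-identityˡ : ∀ {a X Y} (p : 𝟘 ⊥ a) (f : Hom a X Y) →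
                       tensor p (id {𝟘} {I}) f ≅ f
    tensor-assoc     : ∀ {a b c X Y X′ Y′ X″ Y″}
                       (p : a ⊥ b) (q : val (a ⊕ b) p ⊥ c)
                       (r : b ⊥ c) (s : a ⊥ val (b ⊕ c) r)
                       (f : Hom a X Y) (g : Hom b X′ Y′) (k : Hom c X″ Y″) →
                       tensor q (tensor p f g) k ≅ tensor s f (tensor r g k)

    tensor-id : ∀ {X Y} (p : 𝟘 ⊥ 𝟘) →
                tensor p (id {𝟘} {X}) (id {𝟘} {Y}) ≅ id {𝟘} {X ⊗₀ Y}
    tensor-⨾  : ∀ {a b X Y Z X′ Y′ Z′} (p : a ⊥ b)
                (f : Hom a X Y) (k : Hom a Y Z)
                (g : Hom b X′ Y′) (l : Hom b Y′ Z′) →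
                tensor p f g ⨾ tensor p k l ≡ tensor p (f ⨾ k) (g ⨾ l)

{-# OPTIONS --safe #-}
module Submission where

open import Defs
open import Algebra.Core using (Op₂)
open import Data.Product using (Σ-syntax; _,_)
open import Level using (Level)
open import Relation.Binary.Lattice.Bundles using (JoinSemilattice)
open import Relation.Binary.Lattice.Structures using (IsJoinSemilattice)
open import Relation.Binary.PropositionalEquality
  using (_≡_; refl; sym; trans; cong; cong₂; module ≡-Reasoning)
import Relation.Binary.Lattice.Properties.JoinSemilattice as JoinSemilatticeProperties

-- Two arrows of equal grade are equal in the coproduct as soon as regrading
-- along that equality takes one to the other.  Both sides of each law then
-- become composites in a single category ℂ_a, where the law holds already.

𝟘-minimum : {e d : Level} (P : PCM e d) → let open PCM P in ∀ a → 𝟘 ≤ a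
𝟘-minimum P a = a , PCM.⊕-identityˡ P a

module _ {e d o h : Level} (P : PCM e d) (ℂ : GradedMonoidalCategory P o h) where
  open PCM P
  open GradedMonoidalCategory ℂ

  -- Matching on `a ≡ b` turns `p` into a proof of `a ≤ a`, along which `regrade` is the identity.
  -- Stating the agreement of arrows through `regrade` instead of `subst` keeps it within reach of
  -- the regrading laws.
  graded-≡ : ∀ {a b X Y} {f : Hom a X Y} {g : Hom b X Y} →
             a ≡ b → (p : a ≤ b) → regrade p f ≡ g →
             _≡_ {A = Σ[ c ∈ E ] Hom c X Y} (a , f) (b , g)
  graded-≡ {a} {f = f} refl p eq = cong (a ,_) (trans (sym (regrade-refl p f)) eq)

  -- Functoriality of `regrade r` followed by transitivity on each factor. It flattens nested
  -- composites until every arrow is regraded only once; `p′` and `q′` are arbitrary because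
  -- `regrade-trans` accepts any proof of the composite inequality.
  regrade-⨾-regrade :
    ∀ {a b c c′ X Y Z} (p : a ≤ c) (q : b ≤ c) (r : c ≤ c′)
    (p′ : a ≤ c′) (q′ : b ≤ c′) (f : Hom a X Y) (g : Hom b Y Z) →
    regrade r (regrade p f ⨾ regrade q g) ≡ regrade p′ f ⨾ regrade q′ g
  regrade-⨾-regrade p q r p′ q′ f g =
    trans (regrade-⨾ r _ _)
          (cong₂ _⨾_ (regrade-trans p r p′ f) (regrade-trans q r q′ g))

proposition5p1 : {e d o h : Level} (P : PCM e d) → let open PCM P in
    (_∨_ : Op₂ E) (∨-join : IsJoinSemilattice _≡_ _≤_ _∨_) →
    (ℂ : GradedMonoidalCategory P o h) →
    let open GradedMonoidalCategory ℂ in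
    IsCategory {Obj = Obj}
    (λ X Y → Σ[ a ∈ E ] Hom a X Y)
    (𝟘 , id)
    (λ (a , f) (b , g) →
    (a ∨ b) , (regrade (IsJoinSemilattice.x≤x∨y ∨-join a b) f
    ⨾ regrade (IsJoinSemilattice.y≤x∨y ∨-join a b) g))
proposition5p1 P _∨_ ∨-join ℂ = record
  { identityˡ = λ { (a , f) →
      let 𝟘≤a = 𝟘-minimum P a
          𝟘∨a≤a = ∨-least 𝟘≤a ≤-refl
      -- Antisymmetry of the extension preorder, part of `∨-join`, turns the two inequalities into
      -- `𝟘 ∨ a ≡ a`.
      in graded-≡ P ℂ (antisym 𝟘∨a≤a (y≤x∨y 𝟘 a)) 𝟘∨a≤a (begin
        regrade 𝟘∨a≤a (regrade (x≤x∨y 𝟘 a) id ⨾ regrade (y≤x∨y 𝟘 a) f)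
          ≡⟨ regrade-⨾-regrade P ℂ (x≤x∨y 𝟘 a) (y≤x∨y 𝟘 a) 𝟘∨a≤a 𝟘≤a ≤-refl id f ⟩
        regrade 𝟘≤a id ⨾ regrade ≤-refl f
          ≡⟨ cong₂ _⨾_ (regrade-id 𝟘≤a) (regrade-refl ≤-refl f) ⟩
        id ⨾ f
          ≡⟨ IsCategory.identityˡ (isCategory a) f ⟩
        f ∎) }
  ; identityʳ = λ { (a , f) →
      let 𝟘≤a = 𝟘-minimum P a
          a∨𝟘≤a = ∨-least ≤-refl 𝟘≤a
      in graded-≡ P ℂ (antisym a∨𝟘≤a (x≤x∨y a 𝟘)) a∨𝟘≤a (begin
        regrade a∨𝟘≤a (regrade (x≤x∨y a 𝟘) f ⨾ regrade (y≤x∨y a 𝟘) id)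
          ≡⟨ regrade-⨾-regrade P ℂ (x≤x∨y a 𝟘) (y≤x∨y a 𝟘) a∨𝟘≤a ≤-refl 𝟘≤a f id ⟩
        regrade ≤-refl f ⨾ regrade 𝟘≤a id
          ≡⟨ cong₂ _⨾_ (regrade-refl ≤-refl f) (regrade-id 𝟘≤a) ⟩
        f ⨾ id
          ≡⟨ IsCategory.identityʳ (isCategory a) f ⟩
        f ∎) }
  ; assoc = λ { (a , f) (b , g) (c , k) →
      -- With `m` the grade of the right-hand side, only the left-hand composite has to be regraded.
      let m = a ∨ (b ∨ c)
          a≤m = x≤x∨y a (b ∨ c)
          b∨c≤m = y≤x∨y a (b ∨ c)
          b≤m = ≤-trans (x≤x∨y b c) b∨c≤m
          c≤m = ≤-trans (y≤x∨y b c) b∨c≤m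
          a∨b≤m = ∨-least a≤m b≤m
          [a∨b]∨c≤m = ∨-least a∨b≤m c≤m
      in graded-≡ P ℂ (∨-assoc a b c) [a∨b]∨c≤m (begin
        regrade [a∨b]∨c≤m
          (regrade (x≤x∨y (a ∨ b) c) (regrade (x≤x∨y a b) f ⨾ regrade (y≤x∨y a b) g)
           ⨾ regrade (y≤x∨y (a ∨ b) c) k)
          -- Flattening goes from the outside in: the composite of `f` and `g` first counts as a
          -- single arrow of grade `a ∨ b`.
          ≡⟨ regrade-⨾-regrade P ℂ (x≤x∨y (a ∨ b) c) (y≤x∨y (a ∨ b) c)
               [a∨b]∨c≤m a∨b≤m c≤m _ k ⟩
        regrade a∨b≤m (regrade (x≤x∨y a b) f ⨾ regrade (y≤x∨y a b) g) ⨾ regrade c≤m k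
          ≡⟨ cong (_⨾ regrade c≤m k)
               (regrade-⨾-regrade P ℂ (x≤x∨y a b) (y≤x∨y a b) a∨b≤m a≤m b≤m f g) ⟩
        regrade a≤m f ⨾ regrade b≤m g ⨾ regrade c≤m k
          ≡⟨ IsCategory.assoc (isCategory m) _ _ _ ⟩
        regrade a≤m f ⨾ (regrade b≤m g ⨾ regrade c≤m k)
          -- Read backwards, this flattens the right-hand side, whose outer regradings are already
          -- along `a≤m` and `b∨c≤m`.
          ≡⟨ cong (regrade a≤m f ⨾_)
               (regrade-⨾-regrade P ℂ (x≤x∨y b c) (y≤x∨y b c) b∨c≤m b≤m c≤m g k) ⟨
        regrade a≤m f ⨾ regrade b∨c≤m (regrade (x≤x∨y b c) g ⨾ regrade (y≤x∨y b c) k) ∎) }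
  }
  where
  open PCM P
  open GradedMonoidalCategory ℂ
  open IsJoinSemilattice ∨-join
    using (x≤x∨y; y≤x∨y; ∨-least; antisym) renaming (refl to ≤-refl; trans to ≤-trans)
  joinSemilattice : JoinSemilattice _ _ _
  joinSemilattice = record { isJoinSemilattice = ∨-join }
  open JoinSemilatticeProperties joinSemilattice using (∨-assoc)
  open ≡-Reasoning
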